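{- No deterministic online algorithm for $\mathrm{OMP}_5(1,\infty)$ can guarantee a competitive ratio larger than $5/7$.
   Context: Online bipartite matching: an instance $(G,\pi)$ is a finite bipartite graph $G=(L,R,E)$ and an arrival order $\pi$ of $R$. The offline side $L$ is known in advance; online vertices $j\in R$ arrive one by one in order $\pi$, and upon arrival of $j$ all edges incident to $j$ are revealed. The algorithm maintains a matching $M$, initially empty. A vertex is free if it is currently unmatched. $\mathrm{OMP}_K(s,t)$ for $K\ge1$ and $s,t\in\mathbb N\cup\{\infty\}$: upon arrival of $j$, the algorithm either leaves $j$ unmatched (forever, unless matched later by no other means) or replaces $M$ by $M\triangle E(P)$, where $P$ is an $M$-augmenting path of length at most $K$ that starts at $j$ and ends at a free vertex of $L$. A vertex is reassigned by an augmentation if it is matched both before and after it, but to different neighbors (these are exactly the internal vertices of $P$). Over the execution, each vertex of $L$ may be reassigned at most $s$ times and each vertex of $R$ at most $t$ times ($\infty$ means no limit). A deterministic online algorithm is $\rho$-competitive (guarantees ratio $\rho$) if for every instance $(G,\pi)$ its output matching has size at least $\rho\cdot\nu(G)$, where $\nu(G)$ is the maximum size of a matching in $G$. -}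

module Defs where

open import Data.Bool.Base using (_xor_; if_then_else_)
open import Data.Fin.Base using (Fin; zero; suc; opposite)
open import Data.Fin.Permutation using (Permutation′; _⟨$⟩ʳ_)
open import Data.Fin.Properties using (any?; _≟_)
open import Data.Fin.Subset using (Subset; ⊥; ⁅_⁆; _∪_; _∈_; ∣_∣)
open import Data.Fin.Subset.Properties using (_∈?_)
open import Data.Integer.Base using (+_)
open import Data.List.Base using (List; []; _∷_; foldr; length)
open import Data.List.Relation.Unary.All using (All)
open import Data.List.Relation.Unary.Unique.Propositional using (Unique)
open import Data.Maybe.Base using (Maybe; just; nothing)
open import Data.Nat.Base using (ℕ; suc; _+_; _≤_)
open import Data.Product.Base using (∃; ∃-syntax; _×_; _,_)
open import Data.Rational.Base as ℚ using (ℚ)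
open import Data.Vec.Base using (Vec; []; _∷_; lookup; map; replicate; sum; tabulate; zipWith; _[_]%=_)
open import Relation.Binary.Construct.Add.Supremum.NonStrict _≤_ using (_≤⁺_)
open import Relation.Binary.PropositionalEquality using (_≡_; _≢_)
open import Relation.Nullary using (¬_; Dec; does; ¬?; _×-dec_)
open import Relation.Nullary.Construct.Add.Supremum using (_⁺; [_])

private
  variable
    m n : ℕ

-- The offline side L is Fin m and the online side R is Fin n.

Edge : ℕ → ℕ → Set
Edge m n = Fin m × Fin n

-- A set of edges, stored as the neighbourhood in L of each vertex of R.
-- A bipartite graph is identified with its edge set.
EdgeSet : ℕ → ℕ → Set
EdgeSet m n = Vec (Subset m) n

infix 4 _∈ᴱ_ _∉ᴱ_ _⊆ᴱ_
infixl 6 _△_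

_∈ᴱ_ : Edge m n → EdgeSet m n → Set
(i , j) ∈ᴱ E = i ∈ lookup E j

_∉ᴱ_ : Edge m n → EdgeSet m n → Set
e ∉ᴱ E = ¬ (e ∈ᴱ E)

_⊆ᴱ_ : EdgeSet m n → EdgeSet m n → Set
E ⊆ᴱ F = ∀ e → e ∈ᴱ E → e ∈ᴱ F

_△_ : EdgeSet m n → EdgeSet m n → EdgeSet m n
_△_ = zipWith (zipWith _xor_)

size : EdgeSet m n → ℕ
size E = sum (map ∣_∣ E)

fromEdges : List (Edge m n) → EdgeSet m n
fromEdges = foldr (λ (i , j) E → E [ j ]%= (⁅ i ⁆ ∪_)) (replicate _ ⊥)

record IsMatching (G M : EdgeSet m n) : Set where
  field
    subgraph       : M ⊆ᴱ G
    unique-online  : ∀ {i j j′} → (i , j) ∈ᴱ M → (i , j′) ∈ᴱ M → j ≡ j′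
    unique-offline : ∀ {i i′ j} → (i , j) ∈ᴱ M → (i′ , j) ∈ᴱ M → i ≡ i′

-- IsMatchingNumber G ν says that ν = ν(G).
record IsMatchingNumber (G : EdgeSet m n) (ν : ℕ) : Set where
  field
    attained : ∃[ M ] IsMatching G M × size M ≡ ν
    maximal  : ∀ M → IsMatching G M → size M ≤ ν

Freeᴸ : EdgeSet m n → Fin m → Set
Freeᴸ M i = ∀ j → (i , j) ∉ᴱ M

Freeᴿ : EdgeSet m n → Fin n → Set
Freeᴿ M j = ∀ i → (i , j) ∉ᴱ M

-- Vertex sequences from j ∈ R to some vertex of L that alternate between the
-- two sides: end i is j, i and via i j′ P is j, i followed by P, which starts
-- at j′.
data Walk (m n : ℕ) (j : Fin n) : Set where
  end : Fin m → Walk m n j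
  via : Fin m → (j′ : Fin n) → Walk m n j′ → Walk m n j

module _ {m n : ℕ} where

  edges : {j : Fin n} → Walk m n j → List (Edge m n)
  edges {j} (end i)      = (i , j) ∷ []
  edges {j} (via i j′ P) = (i , j) ∷ (i , j′) ∷ edges P

  verticesᴸ : {j : Fin n} → Walk m n j → List (Fin m)
  verticesᴸ (end i)      = i ∷ []
  verticesᴸ (via i j′ P) = i ∷ verticesᴸ P

  verticesᴿ : {j : Fin n} → Walk m n j → List (Fin n)
  verticesᴿ {j} (end i)      = j ∷ []
  verticesᴿ {j} (via i j′ P) = j ∷ verticesᴿ P

  lastVertex : {j : Fin n} → Walk m n j → Fin m
  lastVertex (end i)      = i
  lastVertex (via i j′ P) = lastVertex P

  data Alternating (M : EdgeSet m n) {j : Fin n} : Walk m n j → Set where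
    end : ∀ {i} → (i , j) ∉ᴱ M → Alternating M (end i)
    via : ∀ {i j′ P} → (i , j) ∉ᴱ M → (i , j′) ∈ᴱ M → Alternating M P →
          Alternating M (via i j′ P)

  record IsAugmentingPath (G M : EdgeSet m n) {j : Fin n} (P : Walk m n j) : Set where
    field
      walk-in-graph : All (_∈ᴱ G) (edges P)
      distinctᴸ     : Unique (verticesᴸ P)
      distinctᴿ     : Unique (verticesᴿ P)
      alternating   : Alternating M P
      start-free    : Freeᴿ M j
      end-free      : Freeᴸ M (lastVertex P)

-- M and M′ are the matchings before and after an augmentation.

Reassignedᴸ : (M M′ : EdgeSet m n) → Fin m → Set
Reassignedᴸ M M′ i = ∃[ j ] ∃[ j′ ] (i , j) ∈ᴱ M × (i , j′) ∈ᴱ M′ × j ≢ j′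

Reassignedᴿ : (M M′ : EdgeSet m n) → Fin n → Set
Reassignedᴿ M M′ j = ∃[ i ] ∃[ i′ ] (i , j) ∈ᴱ M × (i′ , j) ∈ᴱ M′ × i ≢ i′

reassignedᴸ? : (M M′ : EdgeSet m n) → ∀ i → Dec (Reassignedᴸ M M′ i)
reassignedᴸ? M M′ i = any? λ j → any? λ j′ →
  (i ∈? lookup M j) ×-dec (i ∈? lookup M′ j′) ×-dec ¬? (j ≟ j′)

reassignedᴿ? : (M M′ : EdgeSet m n) → ∀ j → Dec (Reassignedᴿ M M′ j)
reassignedᴿ? M M′ j = any? λ i → any? λ i′ →
  (i ∈? lookup M j) ×-dec (i′ ∈? lookup M′ j) ×-dec ¬? (i ≟ i′)

-- What has been revealed after k arrivals: the neighbourhoods of the arrived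
-- online vertices, most recent first.  In this graph online vertices are named
-- by age, so zero is the vertex that has just arrived, and a vertex called j
-- becomes suc j when the next one arrives.
History : ℕ → ℕ → Set
History = EdgeSet

-- The response to an arrival: nothing leaves the new vertex unmatched, just P
-- augments along P, which starts at the new vertex.  It depends on L and the
-- revealed graph only; the number of vertices yet to come is unknown.
Strategy : Set
Strategy = ∀ {m k} → History m (suc k) → Maybe (Walk m (suc k) zero)

augment : EdgeSet m n → {j : Fin n} → Maybe (Walk m n j) → EdgeSet m n
augment M nothing  = M
augment M (just P) = M △ fromEdges (edges P)

module Run (A : Strategy) where

  mutual
    matching : ∀ {k} → History m k → EdgeSet m k
    matching []      = []
    matching (N ∷ h) = augment (before h) (A (N ∷ h))

    -- The matching when the next vertex has arrived but is not yet handled.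
    before : ∀ {k} → History m k → EdgeSet m (suc k)
    before h = ⊥ ∷ matching h

  reassignmentsᴸ : ∀ {k} → History m k → Fin m → ℕ
  reassignmentsᴸ []      i = 0
  reassignmentsᴸ (N ∷ h) i =
    (if does (reassignedᴸ? (before h) (matching (N ∷ h)) i) then 1 else 0)
    + reassignmentsᴸ h i

  mutual
    reassignmentsᴿ : ∀ {k} → History m k → Fin k → ℕ
    reassignmentsᴿ (N ∷ h) j =
      (if does (reassignedᴿ? (before h) (matching (N ∷ h)) j) then 1 else 0)
      + earlierᴿ h j

    earlierᴿ : ∀ {k} → History m k → Fin (suc k) → ℕ
    earlierᴿ h zero    = 0
    earlierᴿ h (suc j) = reassignmentsᴿ h j

-- The deterministic online algorithms for OMP_K(s,t), with ⊤⁺ as ∞.  The rules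
-- are imposed on all histories, that is, on all instances.
record OnlineAlgorithm (K : ℕ) (s t : ℕ ⁺) : Set where
  field
    strategy : Strategy

  open Run strategy public

  field
    augmenting : ∀ {m k} (N : Subset m) (h : History m k) {P} →
                 strategy (N ∷ h) ≡ just P →
                 IsAugmentingPath (N ∷ h) (before h) P
    short      : ∀ {m k} (N : Subset m) (h : History m k) {P} →
                 strategy (N ∷ h) ≡ just P →
                 length (edges P) ≤ K
    limitᴸ     : ∀ {m k} (h : History m k) i → [ reassignmentsᴸ h i ] ≤⁺ s
    limitᴿ     : ∀ {m k} (h : History m k) j → [ reassignmentsᴿ h j ] ≤⁺ t

record Instance : Set where
  field
    {offline online} : ℕ
    graph            : EdgeSet offline online
    -- order ⟨$⟩ʳ k is the vertex of R arriving after exactly k others.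
    order            : Permutation′ online

  -- opposite, because histories list the most recent arrival first.
  history : History offline online
  history = tabulate λ k → lookup graph (order ⟨$⟩ʳ opposite k)

fromℕ : ℕ → ℚ
fromℕ n = + n ℚ./ 1

Competitive : ∀ {K s t} → ℚ → OnlineAlgorithm K s t → Set
Competitive ρ A = ∀ (I : Instance) {ν} → let open Instance I in
  IsMatchingNumber graph ν →
  ρ ℚ.* fromℕ ν ℚ.≤ fromℕ (size (OnlineAlgorithm.matching A history))

module Submission where

-- The adversary uses seven offline vertices and keeps all revealed online
-- vertices matchable at once, so after k arrivals the optimum is k.  It wins as
-- soon as the algorithm has left one of at most three, or two of at most seven,
-- arrivals unmatched, the ratio then being at most 5/7.  An offline vertex that
-- was reassigned once is frozen: it keeps its partner forever.  So all replies
-- of the algorithm can be enumerated from the revealed graph, the matching and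
-- the frozen vertices, and a winning strategy tree for the adversary, found by
-- computer search, is verified by evaluation.

open import Data.Bool.Base using (_xor_)
open import Data.Empty as Empty using ()
open import Data.Fin using (#_)
open import Data.Fin.Base using (Fin; zero; suc)
open import Data.Fin.Permutation using (reverse)
open import Data.Fin.Properties using (_≟_; opposite-involutive)
open import Data.Fin.Subset as Subset using (Subset; ⁅_⁆; _∪_; ⋃; ∣_∣; inside; outside)
open import Data.Fin.Subset.Properties
  using (_∈?_; ∉⊥; x∈⁅x⁆; x∈⁅y⁆⇒x≡y; x∈p∪q⁺; x∈p∪q⁻; ∣⁅x⁆∣≡1; ∣⊥∣≡0; p⊆q⇒∣p∣≤∣q∣; nonempty?;
         Empty-unique)
open import Data.Integer.Base as ℤ using (+_)
open import Data.Integer.Properties as ℤ using ()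
open import Data.List.Base as List using (List; []; _∷_; _++_; allFin; concatMap; filter; length)
open import Data.List.Membership.Propositional using (_∈_; _∉_; find; lose)
open import Data.List.Membership.Propositional.Properties
  using (∈-allFin; ∈-concatMap⁺; ∈-filter⁺; ∈-map⁺; ∈-++⁻)
open import Data.List.Properties using (filter-none)
open import Data.List.Relation.Unary.All as All using (All; []; _∷_)
open import Data.List.Relation.Unary.AllPairs using (_∷_)
open import Data.List.Relation.Unary.Any as Any using (Any; here; there)
open import Data.List.Relation.Unary.Unique.Propositional using (Unique)
open import Data.Maybe.Base using (just; nothing)
open import Data.Nat.Base using (ℕ; zero; suc; _+_; _*_; _≤_; z≤n; s≤s)
open import Data.Nat.Properties as ℕ using (_≤?_; ≤-trans; ≤-reflexive; m≤n+m; +-mono-≤)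
open import Data.Product.Base using (∃; ∃-syntax; _×_; _,_)
open import Data.Rational.Base as ℚ using (ℚ; _/_; _>_)
open import Data.Rational.Properties as ℚ using ()
open import Data.Rational.Unnormalised.Base as ℚᵘ using ()
open import Data.Rational.Unnormalised.Properties as ℚᵘ using ()
open import Data.Sum.Base using (inj₁; inj₂; [_,_]′)
open import Data.Unit.Base using (⊤; tt)
open import Data.Vec.Base as Vec using (Vec; []; _∷_; lookup; zipWith; _[_]%=_)
open import Data.Vec.Properties
  using (lookup-zipWith; lookup-map; lookup∘updateAt; lookup∘updateAt′; tabulate-cong;
         tabulate∘lookup)
open import Defs
open import Function.Base using (_∘_; id)
open import Relation.Binary.Construct.Add.Supremum.NonStrict _≤_ using ([≤]-injective)
open import Relation.Binary.PropositionalEquality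
  using (_≡_; refl; sym; trans; cong; subst; subst₂)
open import Relation.Nullary using (¬_; Dec; yes; no; ¬?; _×-dec_; contradiction)
open import Relation.Nullary.Construct.Add.Supremum using ([_]; ⊤⁺)
open import Relation.Nullary.Decidable using (toWitness; dec-true)

private
  variable
    m n k : ℕ

-- Edge sets, symmetric differences and the size of a matching.

∈-updateAt-∪ : ∀ (E : EdgeSet m n) i j → (i , j) ∈ᴱ (E [ j ]%= (⁅ i ⁆ ∪_))
∈-updateAt-∪ E i j
  rewrite lookup∘updateAt j {⁅ i ⁆ ∪_} E = x∈p∪q⁺ (inj₁ (x∈⁅x⁆ i))

⊆-updateAt-∪ : ∀ (E : EdgeSet m n) i j → E ⊆ᴱ (E [ j ]%= (⁅ i ⁆ ∪_))
⊆-updateAt-∪ E i j (i′ , j′) e∈E with j′ ≟ j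
... | yes refl rewrite lookup∘updateAt j {⁅ i ⁆ ∪_} E = x∈p∪q⁺ (inj₂ e∈E)
... | no j′≢j rewrite lookup∘updateAt′ j′ j {⁅ i ⁆ ∪_} j′≢j E = e∈E

∈-fromEdges : ∀ {e : Edge m n} {es} → e ∈ es → e ∈ᴱ fromEdges es
∈-fromEdges {es = (i , j) ∷ es} (here refl)  = ∈-updateAt-∪ (fromEdges es) i j
∈-fromEdges {es = (i , j) ∷ es} (there e∈es) =
  ⊆-updateAt-∪ (fromEdges es) i j _ (∈-fromEdges e∈es)

∈-△ : ∀ (M E : EdgeSet m n) e → e ∉ᴱ M → e ∈ᴱ E → e ∈ᴱ M △ E
∈-△ M E (i , j) e∉M e∈E
  rewrite lookup-zipWith (zipWith _xor_) j M E = go (lookup M j) (lookup E j) i e∉M e∈E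
  where
  go : ∀ {n} (p q : Subset n) i → ¬ i Subset.∈ p → i Subset.∈ q → i Subset.∈ zipWith _xor_ p q
  go (inside  ∷ p) (_ ∷ q) zero    i∉p _                  = contradiction Vec.here i∉p
  go (outside ∷ p) (_ ∷ q) zero    _   Vec.here           = Vec.here
  go (_       ∷ p) (_ ∷ q) (suc i) i∉p (Vec.there i∈q)    =
    Vec.there (go p q i (i∉p ∘ Vec.there) i∈q)

-- Each row holds at most one partner and so contributes at most 1. This caps the matching number by
-- the number of arrivals.
size≤ : (M : EdgeSet m n) → (∀ {i i′ j} → (i , j) ∈ᴱ M → (i′ , j) ∈ᴱ M → i ≡ i′) → size M ≤ n
size≤ []      _  = z≤n
size≤ {m = m} (p ∷ M) uq =
  +-mono-≤ (∣p∣≤1 (nonempty? p)) (size≤ M (λ {_} {_} {j} → uq {j = suc j}))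
  where
  ∣p∣≤1 : Dec (∃ (Subset._∈ p)) → ∣ p ∣ ≤ 1
  ∣p∣≤1 (yes (i , i∈p)) = ≤-trans
    (p⊆q⇒∣p∣≤∣q∣ λ i′∈p → subst (Subset._∈ ⁅ i ⁆) (uq {j = zero} i∈p i′∈p) (x∈⁅x⁆ i))
    (≤-reflexive (∣⁅x⁆∣≡1 i))
  ∣p∣≤1 (no empty) = ≤-trans (≤-reflexive (trans (cong ∣_∣ (Empty-unique empty)) (∣⊥∣≡0 m))) z≤n

-- Systems of distinct representatives and the matchings they give.

⟦_⟧ : List (Fin m) → Subset m
⟦ N ⟧ = ⋃ (List.map ⁅_⁆ N)

∈-⟦⟧⁺ : ∀ {N} {i : Fin m} → i ∈ N → i Subset.∈ ⟦ N ⟧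
∈-⟦⟧⁺ (here refl)         = x∈p∪q⁺ (inj₁ (x∈⁅x⁆ _))
∈-⟦⟧⁺ (there {x = x} i∈N) = x∈p∪q⁺ {p = ⁅ x ⁆} (inj₂ (∈-⟦⟧⁺ i∈N))

∈-⟦⟧⁻ : ∀ N {i : Fin m} → i Subset.∈ ⟦ N ⟧ → i ∈ N
∈-⟦⟧⁻ []      i∈⊥ = contradiction i∈⊥ ∉⊥
∈-⟦⟧⁻ (x ∷ N) i∈N = [ here ∘ x∈⁅y⁆⇒x≡y x , there ∘ ∈-⟦⟧⁻ N ]′ (x∈p∪q⁻ ⁅ x ⁆ ⟦ N ⟧ i∈N)

-- Systems of distinct representatives that avoid the vertices in used.
SDR : List (Fin m) → Vec (List (Fin m)) k → Set
SDR used []       = ⊤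
SDR used (N ∷ Ns) = Any (λ i → i ∉ used × SDR (i ∷ used) Ns) N

_∈ˡ?_ : ∀ (i : Fin m) is → Dec (i ∈ is)
i ∈ˡ? is = Any.any? (i ≟_) is

sdr? : ∀ used (Ns : Vec (List (Fin m)) k) → Dec (SDR used Ns)
sdr? used []       = yes tt
sdr? used (N ∷ Ns) = Any.any? (λ i → ¬? (i ∈ˡ? used) ×-dec sdr? (i ∷ used) Ns) N

revealed : Vec (List (Fin m)) k → History m k
revealed = Vec.map ⟦_⟧

record Saturating (used : List (Fin m)) (G M : EdgeSet m k) : Set where
  field
    isMatching : IsMatching G M
    saturates  : size M ≡ k
    avoids     : ∀ {i j} → (i , j) ∈ᴱ M → i ∉ used

-- The field `avoids` carries the induction: the older vertices are matched away from the
-- representative `i` of the newest one, so adding that edge keeps a matching.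
SDR⇒Saturating : ∀ {used} (Ns : Vec (List (Fin m)) k) → SDR used Ns →
                 ∃[ M ] Saturating used (revealed Ns) M
SDR⇒Saturating [] _ = [] , record
  { isMatching = record
    { subgraph       = λ { (_ , ()) }
    ; unique-online  = λ { {j = ()} }
    ; unique-offline = λ { {j = ()} }
    }
  ; saturates  = refl
  ; avoids     = λ { {j = ()} }
  }
SDR⇒Saturating {used = used} (N ∷ Ns) sdr with find sdr
... | i , i∈N , i∉used , rest with SDR⇒Saturating Ns rest
...   | M , sat = ⁅ i ⁆ ∷ M , record
  { isMatching = record
    { subgraph       = sub
    ; unique-online  = online
    ; unique-offline = λ {i} {i′} {j} → offline {i} {i′} {j}
    }
  ; saturates = trans (cong (_+ size M) (∣⁅x⁆∣≡1 i)) (cong suc saturates)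
  ; avoids    = λ {i} {j} → avoid {i} {j}
  }
  where
  open Saturating sat
  open IsMatching isMatching
  sub : (⁅ i ⁆ ∷ M) ⊆ᴱ revealed (N ∷ Ns)
  sub (i′ , zero)  e rewrite x∈⁅y⁆⇒x≡y i e = ∈-⟦⟧⁺ i∈N
  sub (i′ , suc j) e = subgraph (i′ , j) e
  online : ∀ {i′ j j′} → (i′ , j) ∈ᴱ (⁅ i ⁆ ∷ M) → (i′ , j′) ∈ᴱ (⁅ i ⁆ ∷ M) → j ≡ j′
  online {j = zero}  {zero}   _ _ = refl
  online {j = zero}  {suc j′} p q = contradiction (here (x∈⁅y⁆⇒x≡y i p)) (avoids q)
  online {j = suc j} {zero}   p q = contradiction (here (x∈⁅y⁆⇒x≡y i q)) (avoids p)
  online {j = suc j} {suc j′} p q = cong suc (unique-online p q)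
  offline : ∀ {i′ i″ j} → (i′ , j) ∈ᴱ (⁅ i ⁆ ∷ M) → (i″ , j) ∈ᴱ (⁅ i ⁆ ∷ M) → i′ ≡ i″
  offline {j = zero}  p q = trans (x∈⁅y⁆⇒x≡y i p) (sym (x∈⁅y⁆⇒x≡y i q))
  offline {j = suc j} p q = unique-offline p q
  avoid : ∀ {i′ j} → (i′ , j) ∈ᴱ (⁅ i ⁆ ∷ M) → i′ ∉ used
  avoid {j = zero}  p = subst (_∉ used) (sym (x∈⁅y⁆⇒x≡y i p)) i∉used
  avoid {j = suc j} p = avoids p ∘ there

-- Game states and the enumeration of replies.

-- Neighbourhoods are lists so that the order in which the replies of the
-- algorithm are enumerated is equivariant under renaming offline vertices, which
-- lets the strategy below share its symmetric branches.
record State (m k : ℕ) : Set where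
  field
    neighbours : Vec (List (Fin m)) k
    current    : EdgeSet m k
    frozen     : List (Fin m)

open State

arrive : List (Fin m) → State m k → State m (suc k)
arrive N s .neighbours = N ∷ s .neighbours
arrive N s .current    = Subset.⊥ ∷ s .current
arrive N s .frozen     = s .frozen

interior : {j : Fin k} → Walk m k j → List (Fin m)
interior (end i)      = []
interior (via i j′ P) = i ∷ interior P

follow : State m k → {j : Fin k} → Walk m k j → State m k
follow s P .neighbours = s .neighbours
follow s P .current    = s .current △ fromEdges (edges P)
follow s P .frozen     = interior P ++ s .frozen

module _ (s : State m k) where

  -- All partners are listed, so the enumeration is complete for any edge set `current`, without an
  -- invariant that it is a matching.
  partners : Fin m → List (Fin k)
  partners i = filter (λ j → i ∈? lookup (s .current) j) (allFin k)

  candidates : Fin k → List (Fin m)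
  candidates j = filter (λ i → ¬? (i ∈? lookup (s .current) j)) (lookup (s .neighbours) j)

  -- The first argument bounds the number of interior offline vertices.
  mutual
    walks : ℕ → (j : Fin k) → List (Walk m k j)
    walks b j = concatMap (λ i → walksVia b j i (partners i)) (candidates j)

    walksVia : ℕ → (j : Fin k) → Fin m → List (Fin k) → List (Walk m k j)
    walksVia b       j i []         = end i ∷ []
    walksVia zero    j i (_ ∷ _)    = []
    walksVia (suc b) j i js@(_ ∷ _) with i ∈ˡ? s .frozen
    ... | yes _ = []
    ... | no  _ = concatMap (λ j′ → List.map (via i j′) (walks b j′)) js

  -- Completeness suffices: surplus walks, such as those that repeat a vertex, only add branches
  -- that the adversary must win as well.
  ∈-walks : ∀ b {j} (P : Walk m k j) → All (_∈ᴱ revealed (s .neighbours)) (edges P) →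
            Alternating (s .current) P → Freeᴸ (s .current) (lastVertex P) →
            All (_∉ s .frozen) (interior P) → length (edges P) ≤ suc (b * 2) →
            P ∈ walks b j
  ∈-walks b {j} P P⊆G alt free unfrozen short =
    ∈-concatMap⁺ (λ i → walksVia b j i (partners i)) (first P P⊆G alt free unfrozen short)
    where
    candidate : ∀ {i j} → (i , j) ∈ᴱ revealed (s .neighbours) → (i , j) ∉ᴱ s .current →
                i ∈ candidates j
    candidate {i} {j} e∈G e∉M = ∈-filter⁺ (λ i → ¬? (i ∈? lookup (s .current) j))
      (∈-⟦⟧⁻ (lookup (s .neighbours) j)
        (subst (i Subset.∈_) (lookup-map j ⟦_⟧ (s .neighbours)) e∈G)) e∉M

    first : ∀ {b j} (P : Walk m k j) → All (_∈ᴱ revealed (s .neighbours)) (edges P) →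
            Alternating (s .current) P → Freeᴸ (s .current) (lastVertex P) →
            All (_∉ s .frozen) (interior P) → length (edges P) ≤ suc (b * 2) →
            Any (λ i → P ∈ walksVia b j i (partners i)) (candidates j)
    first (end i) (e∈G ∷ []) (end e∉M) free _ _ = lose (candidate e∈G e∉M) ends
      where
      ends : end i ∈ walksVia _ _ i (partners i)
      -- A free vertex has no partners, so `walksVia` takes its first clause.
      ends rewrite filter-none (λ j → i ∈? lookup (s .current) j) {allFin k}
                     (All.tabulate λ {j} _ → free j) = here refl
    first {zero}  (via i j′ (end _))     _ _ _ _ (s≤s ())
    first {zero}  (via i j′ (via _ _ _)) _ _ _ _ (s≤s ())
    first {suc b} {j} (via i j′ P) (e∈G ∷ _ ∷ P⊆G) (via e∉M e′∈M alt) free (i∉F ∷ unfrozen)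
          (s≤s (s≤s short)) =
      lose (candidate e∈G e∉M) (go (∈-filter⁺ (λ j → i ∈? lookup (s .current) j) (∈-allFin j′) e′∈M))
      where
      go : ∀ {js} → j′ ∈ js → via i j′ P ∈ walksVia (suc b) j i js
      go {_ ∷ _} j′∈js with i ∈ˡ? s .frozen
      ... | yes i∈F = contradiction i∈F i∉F
      ... | no  _   = ∈-concatMap⁺ (λ j′ → List.map (via i j′) (walks b j′))
        (lose j′∈js (∈-map⁺ (via i j′) (∈-walks b P P⊆G alt free unfrozen short)))

-- Winning strategies of the adversary.

-- A strategy of the adversary: play N t ts lets a vertex with neighbourhood N
-- arrive and continues with t if it stays unmatched, and with the entries of ts
-- for the possible augmentations, in the order of walks.
data Tree (m : ℕ) : Set where
  done : Tree m
  play : List (Fin m) → Tree m → List (Tree m) → Tree m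

-- The ratio bound 5/7 without denominators; the representatives certify that the optimum is `k`.
-- The condition `1 ≤ k` excludes the empty instance, on which every ratio is met.
Won : State m k → Set
Won {k = k} s = 1 ≤ k × 7 * size (s .current) ≤ 5 * k × SDR [] (s .neighbours)

mutual
  Forces : Tree m → State m k → Set
  Forces done          s = Won s
  Forces (play N t ts) s =
    -- A path with at most 5 = 1 + 2 * 2 edges has at most 2 interior offline vertices.
    Forces t (arrive N s) × ForcesAll ts (arrive N s) (walks (arrive N s) 2 zero)

  ForcesAll : List (Tree m) → (s : State m k) → {j : Fin k} → List (Walk m k j) → Set
  ForcesAll _        s []       = ⊤
  ForcesAll []       s (_ ∷ _)  = Empty.⊥
  ForcesAll (t ∷ ts) s (P ∷ Ps) = Forces t (follow s P) × ForcesAll ts s Ps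

mutual
  forces? : (t : Tree m) (s : State m k) → Dec (Forces t s)
  forces? {k = k} done s =
    (1 ≤? k) ×-dec (7 * size (s .current) ≤? 5 * k) ×-dec sdr? [] (s .neighbours)
  forces? (play N t ts) s = forces? t (arrive N s) ×-dec forcesAll? ts (arrive N s) _

  forcesAll? : (ts : List (Tree m)) (s : State m k) {j : Fin k} (Ps : List (Walk m k j)) →
               Dec (ForcesAll ts s Ps)
  forcesAll? _        s []       = yes tt
  forcesAll? []       s (_ ∷ _)  = no λ ()
  forcesAll? (t ∷ ts) s (P ∷ Ps) = forces? t (follow s P) ×-dec forcesAll? ts s Ps

initial : State m 0
initial .neighbours = []
initial .current    = []
initial .frozen     = []

-- The strategy tree.

private
  -- Used where the new vertex has no reply: every walk from it meets a frozen vertex or would need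
  -- more than five edges.
  stuck : Fin m → Tree m
  stuck i = play (i ∷ []) done []

  -- Used where either reply loses: the one through `i` blocks `j`, the one through `i′` blocks
  -- `j′`.
  fork : (i i′ j j′ : Fin m) → Tree m
  fork i i′ j j′ = play (i ∷ i′ ∷ []) done (stuck j ∷ stuck j′ ∷ [])

  single : (i j : Fin m) → Tree m
  single i j = play (i ∷ []) done (stuck j ∷ [])

  -- a, c and f are matched to the first three online vertices, with
  -- neighbourhoods a b, c d e and f g a; nothing is frozen.
  afterThird : (a b c d e f g : Fin m) → Tree m
  afterThird a b c d e f g = play (c ∷ f ∷ [])
    (play (c ∷ []) done (fork a e b d ∷ fork a d b e ∷ []))
    -- The replies in order: taking `c` sends the second vertex to `d` or to `e`; taking `f` sends
    -- the third to `g`, or to `a` with the first moving on to `b`.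
    ( play (c ∷ []) (fork a e b d) []
    ∷ play (c ∷ []) (fork a d b e) []
    ∷ play (f ∷ []) (fork d g d b) []
    ∷ play (d ∷ []) (single e b) (play (b ∷ []) (stuck f) [] ∷ [])
    ∷ [])

  -- The third vertex took a, which is now frozen, and moved the first one to b.
  afterShift : (a b c d e f g : Fin m) → Tree m
  afterShift a b c d e f g = play (b ∷ [])
    (play (c ∷ d ∷ []) done
      (single f c ∷ single f c ∷ fork d f e f ∷ []))
    []

  afterSecond : (a b c d e f g : Fin m) → Tree m
  afterSecond a b c d e f g = play (f ∷ g ∷ a ∷ []) done
    ( afterThird a b c d e f g
    ∷ afterThird a b c d e g f
    ∷ afterShift a b c d e f g
    ∷ [])

  afterFirst : (a b c d e f g : Fin m) → Tree m
  afterFirst a b c d e f g = play (c ∷ d ∷ e ∷ []) done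
    ( afterSecond a b c d e f g
    ∷ afterSecond a b d c e f g
    ∷ afterSecond a b e c d f g
    ∷ [])

adversary : Tree 7
adversary = play (# 0 ∷ # 1 ∷ []) done
  ( afterFirst (# 0) (# 1) (# 2) (# 3) (# 4) (# 5) (# 6)
  ∷ afterFirst (# 1) (# 0) (# 2) (# 3) (# 4) (# 5) (# 6)
  ∷ [])

adversary-forces : Forces adversary initial
adversary-forces = toWitness {a? = forces? adversary initial} tt

-- Playing the tree against an actual algorithm.

start∈verticesᴿ : {j : Fin n} (P : Walk m n j) → j ∈ verticesᴿ P
start∈verticesᴿ (end _)     = here refl
start∈verticesᴿ (via _ _ _) = here refl

-- An interior vertex trades its partner `j′` for its predecessor `j` on the path, and online
-- vertices do not repeat. The list `es` stays that of the whole path while the induction descends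
-- to suffixes.
interior-reassigned : ∀ {M : EdgeSet m n} {es} {i j} {P : Walk m n j} →
                      (∀ {e} → e ∈ edges P → e ∈ es) →
                      Alternating M P → Unique (verticesᴿ P) →
                      i ∈ interior P → Reassignedᴸ M (M △ fromEdges es) i
interior-reassigned {M = M} {es} {j = j} {via i j′ P} P⊆es (via e∉M e′∈M _) (j≢ ∷ _) (here refl) =
  j′ , j , e′∈M , ∈-△ M (fromEdges es) (i , j) e∉M (∈-fromEdges (P⊆es (here refl))) ,
  All.lookup j≢ (start∈verticesᴿ P) ∘ sym
interior-reassigned P⊆es (via _ _ alt) (_ ∷ unique) (there i∈P) =
  interior-reassigned (P⊆es ∘ there ∘ there) alt unique i∈P

module _ (A : OnlineAlgorithm 5 [ 1 ] ⊤⁺) where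

  open OnlineAlgorithm A

  matching-∷ : ∀ (N : Subset m) (h : History m k) {r} → strategy (N ∷ h) ≡ r →
               augment (before h) r ≡ matching (N ∷ h)
  matching-∷ N h eq = cong (augment (before h)) (sym eq)

  reassignmentsᴸ-∷ : ∀ (N : Subset m) (h : History m k) {i} →
                     Reassignedᴸ (before h) (matching (N ∷ h)) i →
                     reassignmentsᴸ (N ∷ h) i ≡ suc (reassignmentsᴸ h i)
  reassignmentsᴸ-∷ N h {i} re
    rewrite dec-true (reassignedᴸ? (before h) (matching (N ∷ h)) i) re = refl

  record Faithful (s : State m k) : Set where
    constructor faithful
    field
      current≡ : s .current ≡ matching (revealed (s .neighbours))
      frozen≥1 : ∀ {i} → i ∈ s .frozen → 1 ≤ reassignmentsᴸ (revealed (s .neighbours)) i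

  Defeat : ℕ → Set
  Defeat m = ∃[ k ] ∃[ s ] Won {m} {k} s × Faithful s

  module _ (N : List (Fin m)) {s : State m k} (F : Faithful s) where

    private
      h = revealed (s .neighbours)

    open Faithful F

    faithful-nothing : strategy (⟦ N ⟧ ∷ h) ≡ nothing → Faithful (arrive N s)
    faithful-nothing eq = faithful
      (trans (cong (Subset.⊥ ∷_) current≡) (matching-∷ ⟦ N ⟧ h eq))
      (λ i∈F → ≤-trans (frozen≥1 i∈F) (m≤n+m _ _))

    module _ {P} (eq : strategy (⟦ N ⟧ ∷ h) ≡ just P) where

      open IsAugmentingPath (augmenting ⟦ N ⟧ h eq)

      private
        reassigned : ∀ {i} → i ∈ interior P →
                     reassignmentsᴸ (⟦ N ⟧ ∷ h) i ≡ suc (reassignmentsᴸ h i)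
        reassigned i∈P = reassignmentsᴸ-∷ ⟦ N ⟧ h
          (subst (λ M → Reassignedᴸ (before h) M _) (matching-∷ ⟦ N ⟧ h eq)
            (interior-reassigned id alternating distinctᴿ i∈P))

        -- A frozen interior vertex would be reassigned a second time, against the limit 1.
        unfrozen : ∀ {i} → i ∈ interior P → i ∉ s .frozen
        unfrozen {i} i∈P i∈F = ℕ.<⇒≱ (s≤s (frozen≥1 i∈F))
          (subst (_≤ 1) (reassigned i∈P) ([≤]-injective (limitᴸ (⟦ N ⟧ ∷ h) i)))

      faithful-just : Faithful (follow (arrive N s) P)
      faithful-just = faithful
        (trans (cong (λ M → (Subset.⊥ ∷ M) △ fromEdges (edges P)) current≡)
               (matching-∷ ⟦ N ⟧ h eq))
        (λ i∈ → [ (λ i∈P → subst (1 ≤_) (sym (reassigned i∈P)) (s≤s z≤n))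
                , (λ i∈F → ≤-trans (frozen≥1 i∈F) (m≤n+m _ _)) ]′ (∈-++⁻ (interior P) i∈))

      response∈walks : P ∈ walks (arrive N s) 2 zero
      response∈walks = ∈-walks (arrive N s) 2 P walk-in-graph
        (subst (λ M → Alternating (Subset.⊥ ∷ M) P) (sym current≡) alternating)
        (subst (λ M → Freeᴸ (Subset.⊥ ∷ M) (lastVertex P)) (sym current≡) end-free)
        (All.tabulate unfrozen)
        (short ⟦ N ⟧ h eq)

  mutual
    -- The actual reply of the algorithm selects the branch, and `response∈walks` ensures that the
    -- tree has one for it.
    forced : (t : Tree m) {s : State m k} → Forces t s → Faithful s → Defeat m
    forced done won F = _ , _ , won , F
    forced (play N t ts) {s} (unmatched , augmented) F
      with strategy (⟦ N ⟧ ∷ revealed (s .neighbours)) in eq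
    ... | nothing = forced t unmatched (faithful-nothing N F eq)
    ... | just P  = forcedAll ts augmented (response∈walks N F eq) (faithful-just N F eq)

    forcedAll : (ts : List (Tree m)) {s : State m k} {j : Fin k} {Ps : List (Walk m k j)} →
                ForcesAll ts s Ps → ∀ {P} → P ∈ Ps → Faithful (follow s P) → Defeat m
    forcedAll (t ∷ ts) (forces , _) (here refl) F = forced t forces F
    forcedAll (t ∷ ts) (_ , forces) (there P∈)  F = forcedAll ts forces P∈ F

-- From a won game to the competitive ratio.

inOrder : History m k → Instance
inOrder h = record { graph = h ; order = reverse }

-- The arrival order `reverse` cancels the `opposite` in `history`.
history-inOrder : (h : History m k) → Instance.history (inOrder h) ≡ h
history-inOrder h = trans
  (tabulate-cong λ j → cong (lookup h) (opposite-involutive j))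
  (tabulate∘lookup h)

matchingNumber : {Ns : Vec (List (Fin m)) k} → SDR [] Ns → IsMatchingNumber (revealed Ns) k
matchingNumber {Ns = Ns} sdr with SDR⇒Saturating Ns sdr
... | M , sat = record
  { attained = M , Saturating.isMatching sat , Saturating.saturates sat
  ; maximal  = λ M′ isM′ → size≤ M′ (IsMatching.unique-offline isM′)
  }

fromℕ≤5/7*fromℕ : ∀ a b → 7 * a ≤ 5 * b → fromℕ a ℚ.≤ + 5 / 7 ℚ.* fromℕ b
fromℕ≤5/7*fromℕ a b 7a≤5b = ℚ.toℚᵘ-cancel-≤ (begin
  ℚ.toℚᵘ (fromℕ a)                     ≃⟨ ℚ.toℚᵘ-fromℚᵘ (ℚᵘ.mkℚᵘ (+ a) 0) ⟩
  ℚᵘ.mkℚᵘ (+ a) 0                      ≤⟨ ℚᵘ.*≤* (subst₂ ℤ._≤_ (sym lhs) rhs (ℤ.+≤+ 7a≤5b)) ⟩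
  -- `mkℚᵘ` takes the denominator minus one, so `mkℚᵘ (+ 5) 6` is 5/7.
  ℚᵘ.mkℚᵘ (+ 5) 6 ℚᵘ.* ℚᵘ.mkℚᵘ (+ b) 0 ≃⟨ ℚᵘ.*-congˡ {ℚᵘ.mkℚᵘ (+ 5) 6} (ℚ.toℚᵘ-fromℚᵘ (ℚᵘ.mkℚᵘ (+ b) 0)) ⟨
  ℚ.toℚᵘ (+ 5 / 7) ℚᵘ.* ℚ.toℚᵘ (fromℕ b) ≃⟨ ℚ.toℚᵘ-homo-* (+ 5 / 7) (fromℕ b) ⟨
  ℚ.toℚᵘ (+ 5 / 7 ℚ.* fromℕ b)         ∎)
  where
  open ℚᵘ.≤-Reasoning
  lhs : + a ℤ.* + 7 ≡ + (7 * a)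
  lhs = trans (sym (ℤ.pos-* a 7)) (cong +_ (ℕ.*-comm a 7))
  rhs : + (5 * b) ≡ + 5 ℤ.* + b ℤ.* + 1
  rhs = trans (ℤ.pos-* 5 b) (sym (ℤ.*-identityʳ _))

proposition31 : (A : OnlineAlgorithm 5 [ 1 ] ⊤⁺) (ρ : ℚ) → ρ > + 5 / 7 →
    ¬ Competitive ρ A
proposition31 A ρ ρ>5/7 competitive
  with forced A adversary {initial} adversary-forces (faithful refl λ ())
-- Only `suc k` remains since `Won` contains `1 ≤ k`; a positive optimum keeps the comparison with
-- `ρ` strict.
... | suc k , s , (_ , few , sdr) , F = ℚ.<-irrefl refl (begin-strict
  fromℕ (size (s .current))      ≤⟨ fromℕ≤5/7*fromℕ (size (s .current)) (suc k) few ⟩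
  + 5 / 7 ℚ.* fromℕ (suc k)      <⟨ ℚ.*-monoˡ-<-pos (fromℕ (suc k)) {{ℚ.normalize-pos (suc k) 1}} ρ>5/7 ⟩
  ρ ℚ.* fromℕ (suc k)            ≤⟨ competitive (inOrder h) (matchingNumber {Ns = s .neighbours} sdr) ⟩
  fromℕ (size (matching (Instance.history (inOrder h))))
                                 ≡⟨ cong (fromℕ ∘ size ∘ matching) (history-inOrder h) ⟩
  fromℕ (size (matching h))      ≡⟨ cong (fromℕ ∘ size) (Faithful.current≡ F) ⟨
  fromℕ (size (s .current))      ∎)
  where
  open OnlineAlgorithm A using (matching)
  open ℚ.≤-Reasoning
  h = revealed (s .neighbours)
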